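{- Suppose $S\subseteq 2^{<\omega_1}$ is a complete coherent Suslin tree and $\mathcal{F}$ is a 2-thin Kurepa family with respect to $S$. Then there is a coloring $c:[S]^2\to 2$ satisfying the following properties. (coh) For all $s<_S t$ in $S$, the set $\{x<_S s: c(x,s)\neq c(x,t)\}$ is finite. (hom) For every $\alpha<\omega_1$, $s\in S\upharpoonright\alpha$, $0<n<\omega$, $\mathscr{A}\in\mathcal{F}\cap[\mathcal{X}_{s,n}]^{\omega_1}$, and every $a\in[S_\alpha]^2$ with $D_{a(0),a(1)}=\{ht(s)\}$, for all but finitely many $b\in\mathscr{A}\cap[S\upharpoonright\alpha]^{<\omega}$ there exists $i<2$ such that if $b(2n-1)<_S a(1)$, then $$c(b(j),a(0))=i\ \text{ and }\ c(b(n+j),a(1))=1-i\quad\text{for all } j<n.$$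
   Context: Trees. A Suslin tree here is an uncountable subset $S\subseteq2^{<\omega_1}$ closed under initial segments, ordered by $<_S$ (proper extension of functions), with no uncountable chain and no uncountable antichain. For $t\in S$, $ht(t)=dom(t)$; $S_\alpha=\{t\in S:ht(t)=\alpha\}$; $S\upharpoonright\alpha=\bigcup_{\beta<\alpha}S_\beta$. For $s,t\in2^{<\omega_1}$, $\Delta(s,t)=\max\{\alpha\le\min\{dom(s),dom(t)\}:s\upharpoonright\alpha=t\upharpoonright\alpha\}$ and $D_{s,t}=\{\xi<\min\{dom(s),dom(t)\}:s(\xi)\ne t(\xi)\}$. $S$ is coherent if $D_{s,t}$ is finite for all $s,t\in S$; a coherent $S$ is complete if for all $s\in S$ and $t\in2^{ht(s)}$, $D_{s,t}$ finite implies $t\in S$. Height order. For $s\ne t$ in $2^{<\omega_1}$, $s<_{ho}t$ iff $ht(s)<ht(t)$, or $ht(s)=ht(t)$ and $s(\Delta(s,t))<t(\Delta(s,t))$. For finite $a\subseteq2^{<\omega_1}$, $a(0),a(1),\dots,a(|a|-1)$ is the $<_{ho}$-increasing enumeration of $a$. For $s\in S$ and $0<n<\omega$, $\mathcal{X}_{s,n}$ is the collection of all $a\in[S]^{2n}$ such that (1) $s\cup\{(ht(s),0)\}<_Sa(0)<_S\dots<_Sa(n-1)$ and $s\cup\{(ht(s),1)\}<_Sa(n)<_S\dots<_Sa(2n-1)$; (2) $ht(a(n-1))<ht(a(n))$ and $D_{a(n-1),a(n)}=\{ht(s)\}$. $\mathscr{A}\subseteq[S]^{<\omega}$ is non-overlapping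 if for $a\ne b$ in $\mathscr{A}$, either $\max\{ht(s):s\in a\}<\min\{ht(t):t\in b\}$ or $\max\{ht(t):t\in b\}<\min\{ht(s):s\in a\}$. For $a\subseteq S$ and $\mathcal{F}'\subseteq P([S]^{<\omega})$ consisting of pairwise disjoint families, $cl(a,\mathcal{F}')$ is the $\subseteq$-least $a^*\subseteq S$ such that $a\subseteq a^*$ and for all $\mathscr{A}\in\mathcal{F}'$, $b\in\mathscr{A}$, either $b\cap a^*=\emptyset$ or $b\subseteq a^*$. $\mathcal{F}$ is a 2-thin Kurepa family with respect to $S$ if $\mathcal{F}\subseteq\bigcup\{[\mathcal{X}_{s,n}]^{\omega_1}:s\in S,0<n<\omega\}$ and: (i) for every $\alpha<\omega_1$, $|\{\mathscr{A}\cap[S\upharpoonright\alpha]^{<\omega}:\mathscr{A}\in\mathcal{F}\}|\le\omega$; (ii) for every $s\in S$, $0<n<\omega$ and every uncountable pairwise disjoint $\mathscr{A}\subseteq\mathcal{X}_{s,n}$ there is $\mathscr{B}\in\mathcal{F}$ with $|\mathscr{A}\cap\mathscr{B}|=\omega_1$; (iii) for every $a\in[S]^{<\omega}$ and $\mathcal{F}'\in[\mathcal{F}]^{<\omega}$, $cl(a,\mathcal{F}')$ is finite; (iv) every $\mathscr{A}\in\mathcal{F}$ is non-overlapping. For a coloring $c:[S]^2\to2$, $c(x,y)$ denotes $c(\{x,y\})$. -}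

module Defs where

open import Data.Bool.Base as Bool using (Bool; false; true)
open import Data.Fin.Base using (Fin; zero; fromℕ; _↑ˡ_; _↑ʳ_)
open import Data.Irrelevant using ([_])
open import Data.List.Base using (List)
open import Data.List.Membership.Propositional using () renaming (_∈_ to _∈ˡ_)
import Data.List.Relation.Unary.All as List
open import Data.Nat.Base using (ℕ; suc; _+_; NonZero)
open import Data.Product.Base using (Σ-syntax; ∃; ∃-syntax; _×_; _,_; proj₁; proj₂)
open import Data.Refinement using (Refinement; Refinement-syntax; _,_; value)
open import Data.Sum.Base using (_⊎_; inj₁; inj₂)
open import Data.Vec.Base using (Vec; []; _∷_; lookup; tabulate)
open import Data.Vec.Relation.Unary.All using (All; []; _∷_)
open import Data.Vec.Relation.Unary.All.Properties using (lookup⁺)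
open import Data.Vec.Relation.Unary.AllPairs using (AllPairs; []; _∷_)
open import Data.Vec.Relation.Unary.Linked using (Linked)
open import Function.Bundles using (_⇔_)
open import Function.Definitions using (Injective)
open import Induction.WellFounded using (WellFounded)
open import Level using (Level; 0ℓ)
import Relation.Binary.Construct.StrictToNonStrict as NonStrict
open import Relation.Binary.Core using (Rel)
open import Relation.Binary.Structures using (IsStrictTotalOrder)
open import Relation.Binary.PropositionalEquality using (_≡_; _≢_; refl; sym; subst)
open import Relation.Nullary.Negation using (¬_)
open import Relation.Unary using (Pred; _∈_; _⊆_; _≐_; _∩_; _⊥_; ｛_｝; U)

private
  variable
    a p ℓ : Level
    A : Set a

Finite : Pred A p → Set _
Finite P = ∃[ xs ] P ≐ (_∈ˡ xs)

-- |P| ≤ ω, where elements related by _≈_ are counted once.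
CountableUpTo : Rel A ℓ → Pred A p → Set _
CountableUpTo {A = A} _≈_ P =
  Σ[ f ∈ (A → ℕ) ] (∀ {x y} → x ∈ P → y ∈ P → x ≈ y ⇔ f x ≡ f y)

Countable Uncountable : Pred A p → Set _
Countable   = CountableUpTo _≡_
Uncountable P = ¬ Countable P

-- _<_ is the order of the least uncountable ordinal.
record Isω₁ {Ω : Set} (_<_ : Rel Ω 0ℓ) : Set where
  field
    isStrictTotalOrder : IsStrictTotalOrder _≡_ _<_
    wellFounded        : WellFounded _<_
    uncountable        : Uncountable {A = Ω} U
    segmentsCountable  : ∀ α → Countable (_< α)

  open IsStrictTotalOrder isStrictTotalOrder public using () renaming (trans to <-trans)

first last : ∀ n .{{_ : NonZero n}} → Fin n
first (suc n) = zero
last  (suc n) = fromℕ n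

module Trees {Ω : Set} (_<_ : Rel Ω 0ℓ) where

  open NonStrict _≡_ _<_ using (_≤_) public

  HasSizeω₁ : Pred A p → Set _
  HasSizeω₁ {A = A} P =
    Σ[ f ∈ (Ω → A) ] Injective _≡_ _≡_ f × P ≐ (λ x → ∃[ α ] f α ≡ x)

  -- The elements of 2^{<ω₁}, with 2 = {false < true}.
  record Node : Set where
    constructor node
    field
      ht  : Ω
      val : [ ξ ∈ Ω ∣ ξ < ht ] → Bool

  open Node public

  _⟨_⟩ : (t : Node) {ξ : Ω} → .(ξ < ht t) → Bool
  t ⟨ ξ<ht ⟩ = val t (_ , [ ξ<ht ])

  -- s ↾ α = t ↾ α, for α at most both heights.
  AgreeBelow : Node → Node → Ω → Set
  AgreeBelow s t α =
    ∀ {ξ} → ξ < α → (p : ξ < ht s) (q : ξ < ht t) → s ⟨ p ⟩ ≡ t ⟨ q ⟩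

  infix 4 _<S_ _<ho_

  _<S_ : Rel Node 0ℓ
  s <S t = ht s < ht t × AgreeBelow s t (ht s)

  record IsΔ (s t : Node) (δ : Ω) : Set where
    field
      ≤ˡ      : δ ≤ ht s
      ≤ʳ      : δ ≤ ht t
      agree   : AgreeBelow s t δ
      maximal : ∀ α → α ≤ ht s → α ≤ ht t → AgreeBelow s t α → α ≤ δ

  D : Node → Node → Pred Ω 0ℓ
  D s t ξ = Σ[ p ∈ ξ < ht s ] Σ[ q ∈ ξ < ht t ] s ⟨ p ⟩ ≢ t ⟨ q ⟩

  _<ho_ : Rel Node 0ℓ
  s <ho t =
      ht s < ht t
    ⊎ ht s ≡ ht t
      × ∃[ δ ] IsΔ s t δ
      × Σ[ p ∈ δ < ht s ] Σ[ q ∈ δ < ht t ] s ⟨ p ⟩ Bool.< t ⟨ q ⟩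

  -- u = s ∪ {(ht s , i)}; the first field says dom u = dom s ∪ {ht s}.
  record IsExtensionBy (s : Node) (i : Bool) (u : Node) : Set where
    field
      domain  : ∀ {ξ} → ξ < ht u ⇔ (ξ < ht s ⊎ ξ ≡ ht s)
      extends : AgreeBelow s u (ht s)
      top     : (p : ht s < ht u) → u ⟨ p ⟩ ≡ i

  Chain Antichain : Pred Node 0ℓ → Set
  Chain     C = ∀ {s t} → s ∈ C → t ∈ C → s <S t ⊎ s ≡ t ⊎ t <S s
  Antichain C = ∀ {s t} → s ∈ C → t ∈ C → s ≢ t → ¬ (s <S t) × ¬ (t <S s)

  record IsSuslinTree (S : Pred Node 0ℓ) : Set₁ where
    field
      uncountable  : Uncountable S
      closed       : ∀ {s t} → t ∈ S → s <S t → s ∈ S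
      noChain      : ¬ (∃[ C ] C ⊆ S × Chain C × Uncountable C)
      noAntichain  : ¬ (∃[ C ] C ⊆ S × Antichain C × Uncountable C)

  Coherent : Pred Node 0ℓ → Set
  Coherent S = ∀ {s t} → s ∈ S → t ∈ S → Finite (D s t)

  Complete : Pred Node 0ℓ → Set
  Complete S = ∀ {s t} → s ∈ S → ht t ≡ ht s → Finite (D s t) → t ∈ S

  _↾_ level : Pred Node 0ℓ → Ω → Pred Node 0ℓ
  S ↾ α     = S ∩ λ t → ht t < α
  level S α = S ∩ λ t → ht t ≡ α

  module Families (S : Pred Node 0ℓ) where

    El : Set
    El = [ t ∈ Node ∣ t ∈ S ]

    -- A finite subset of S is represented by its <ho-increasing enumeration;
    -- since the proofs are irrelevant, _≡_ on these is equality of sets.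
    [S]^_ : ℕ → Set
    [S]^ k = [ a ∈ Vec Node k ∣ AllPairs _<ho_ a × All (_∈ S) a ]

    [S]^<ω : Set
    [S]^<ω = ∃ [S]^_

    -- a ! i is a(i) in the height order.
    _!_ : ∀ {k} → [S]^ k → Fin k → El
    (a , [ p ]) ! i = lookup a i , [ lookup⁺ (proj₂ p) i ]

    ⟦_⟧ : [S]^<ω → Pred Node 0ℓ
    ⟦ _ , a ⟧ t = ∃[ i ] value (a ! i) ≡ t

    -- {x , y}, for x of smaller height than y.
    ⟪_,_⟫ : (x y : El) → .(ht (value x) < ht (value y)) → [S]^ 2
    ⟪ (x , [ x∈S ]) , (y , [ y∈S ]) ⟫ x<y =
      (x ∷ y ∷ []) , [ ((inj₁ x<y ∷ []) ∷ [] ∷ []) , (x∈S ∷ y∈S ∷ []) ]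

    -- {b(i) , a(j)}, for b below the level of a.
    cross : ∀ {α k m} (b : [S]^ k) (a : [S]^ m) →
            ⟦ _ , b ⟧ ⊆ S ↾ α → ⟦ _ , a ⟧ ⊆ level S α → Fin k → Fin m → [S]^ 2
    cross b a b⊆ a⊆ i j =
      ⟪ b ! i , a ! j ⟫ (subst (_ <_) (sym (proj₂ (a⊆ (j , refl)))) (proj₂ (b⊆ (i , refl))))

    Family : Set₁
    Family = Pred [S]^<ω 0ℓ

    data 𝒳 (s : Node) (n : ℕ) .{{_ : NonZero n}} : Family where
      mk : ∀ (a : [S]^ (n + n)) {s₀ s₁} →
           let lower : Fin n → Node
               lower j = value (a ! (j ↑ˡ n))
               upper : Fin n → Node
               upper j = value (a ! (n ↑ʳ j)) in
           IsExtensionBy s false s₀ → Linked _<S_ (s₀ ∷ tabulate lower) →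
           IsExtensionBy s true  s₁ → Linked _<S_ (s₁ ∷ tabulate upper) →
           ht (lower (last n)) < ht (upper (first n)) →
           D (lower (last n)) (upper (first n)) ≐ ｛ ht s ｝ →
           𝒳 s n (n + n , a)

    -- max ht a < min ht b (and vice versa), quantified over all elements.
    NonOverlapping PairwiseDisjoint : Family → Set
    NonOverlapping 𝒜 = ∀ {a b} → a ∈ 𝒜 → b ∈ 𝒜 → a ≢ b →
        (∀ {x y} → x ∈ ⟦ a ⟧ → y ∈ ⟦ b ⟧ → ht x < ht y)
      ⊎ (∀ {x y} → x ∈ ⟦ a ⟧ → y ∈ ⟦ b ⟧ → ht y < ht x)
    PairwiseDisjoint 𝒜 = ∀ {a b} → a ∈ 𝒜 → b ∈ 𝒜 → a ≢ b → ⟦ a ⟧ ⊥ ⟦ b ⟧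

    ClosedUnder : List Family → Pred Node 0ℓ → Set₁
    ClosedUnder 𝓕′ a* = ∀ {𝒜 b} → 𝒜 ∈ˡ 𝓕′ → b ∈ 𝒜 → ⟦ b ⟧ ⊥ a* ⊎ ⟦ b ⟧ ⊆ a*

    -- a* = cl(a , 𝓕′)
    record IsCl (a : Pred Node 0ℓ) (𝓕′ : List Family) (a* : Pred Node 0ℓ) : Set₁ where
      field
        ⊆S       : a* ⊆ S
        contains : a ⊆ a*
        closed   : ClosedUnder 𝓕′ a*
        least    : ∀ {b} → b ⊆ S → a ⊆ b → ClosedUnder 𝓕′ b → a* ⊆ b

    -- {𝒜 ∩ [S ↾ α]^{<ω} : 𝒜 ∈ 𝓕}
    Traces : Pred Family 0ℓ → Ω → Pred Family _
    Traces 𝓕 α 𝒞 = ∃[ 𝒜 ] 𝒜 ∈ 𝓕 × 𝒞 ≐ (𝒜 ∩ λ a → ⟦ a ⟧ ⊆ S ↾ α)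

    record Is2ThinKurepa (𝓕 : Pred Family 0ℓ) : Set₁ where
      field
        families : ∀ {𝒜} → 𝒜 ∈ 𝓕 →
          ∃[ s ] s ∈ S × ∃[ n ] Σ[ n>0 ∈ NonZero n ]
            𝒜 ⊆ 𝒳 s n {{n>0}} × HasSizeω₁ 𝒜
        thin : ∀ α → CountableUpTo _≐_ (Traces 𝓕 α)
        catches : ∀ {s} → s ∈ S → ∀ n .{{_ : NonZero n}} (𝒜 : Family) →
          𝒜 ⊆ 𝒳 s n → Uncountable 𝒜 → PairwiseDisjoint 𝒜 →
          ∃[ ℬ ] ℬ ∈ 𝓕 × HasSizeω₁ (𝒜 ∩ ℬ)
        finiteClosure : ∀ (a : [S]^<ω) 𝓕′ → List.All (_∈ 𝓕) 𝓕′ →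
          ∃[ a* ] IsCl ⟦ a ⟧ 𝓕′ a* × Finite a*
        nonOverlapping : ∀ {𝒜} → 𝒜 ∈ 𝓕 → NonOverlapping 𝒜

{-# OPTIONS --safe #-}

-- We put c(x , t) = g_α(x) with α = ht(t), where the g_α : 2^{<ω₁} → 2 are defined by recursion
-- so that they cohere modulo finite sets and g_α splits almost every b ∈ 𝒜 below α, for each
-- 𝒜 ∈ 𝓕: it is constant on either half of b, with different values. At successors only one new
-- b per family appears, as families are non-overlapping. At a limit α take countably many families
-- 𝒜₀, 𝒜₁, … representing all traces and suitable θ₀ < θ₁ < … cofinal in α. Some b ∈ 𝒜ₘ with m < k
-- that reach below θₖ are badly coloured by the old colouring at θₖ or stick out of its domain.
-- They are finitely many, so a finite set Kₖ closed under 𝒜₀, …, 𝒜ₖ₋₁ contains them. The elements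
-- x of Kₖ not coloured before stage k get as colour the parity of x on {ζ₀, …, ζₖ₋₁}, where b ∈ 𝒜ₘ
-- splits at height ζₘ: the halves of b differ at ζₘ but at no other ordinal of that set.
module Submission where

open import Axiom.ExcludedMiddle using (ExcludedMiddle)
open import Axiom.Extensionality.Propositional using (Extensionality; implicit-extensionality)
open import Data.Bool.Base using (Bool; true; false; not; _xor_)
open import Data.Bool.Properties using (xor-assoc; xor-comm; xor-same; not-involutive) renaming (_≟_ to _≟ᵇ_)
open import Data.Fin.Base as Fin using (Fin; zero; suc; _↑ˡ_; _↑ʳ_; fromℕ; splitAt; join)
import Data.Fin.Properties as Fin
open import Data.Irrelevant using ([_])
open import Data.List.Base using (List; []; _∷_; _++_; map; filter; upTo; applyUpTo)
open import Data.List.Membership.Propositional using () renaming (_∈_ to _∈ˡ_)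
open import Data.List.Membership.Propositional.Properties using (∈-filter⁺; ∈-filter⁻; ∈-++⁺ˡ; ∈-++⁺ʳ; ∈-++⁻; ∈-map⁺; ∈-upTo⁺; ∈-upTo⁻; ∈-applyUpTo⁺; ∈-applyUpTo⁻)
open import Data.List.Relation.Unary.All.Properties using (applyUpTo⁺₂)
open import Data.List.Relation.Unary.Any using (here; there)
open import Data.Nat.Base as ℕ using (ℕ; zero; suc; NonZero; _+_; s≤s; z<s)
import Data.Nat.Induction as ℕ
import Data.Nat.Properties as ℕ
open import Data.Product.Base using (Σ-syntax; ∃; ∃-syntax; _×_; _,_; proj₁; proj₂)
open import Data.Refinement using (_,_; value; value-injective)
open import Data.Sum.Base using (_⊎_; inj₁; inj₂; [_,_]′)
open import Data.Vec.Base using (tabulate; _∷_)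
open import Data.Vec.Properties using (lookup∘tabulate)
import Data.Vec.Relation.Unary.Linked as Linked
open import Data.Vec.Relation.Unary.Linked using (Linked)
import Data.Vec.Relation.Unary.Linked.Properties as Linked
open import Function.Base using (_∘_; id; case_of_)
open import Function.Bundles using (Equivalence)
open import Function.Definitions using (Injective)
import Induction.WellFounded as WF
open import Level using (Level; 0ℓ)
open import Relation.Binary.Core using (Rel)
open import Relation.Binary.Definitions using (Transitive; tri<; tri≈; tri>)
open import Relation.Binary.PropositionalEquality using (_≡_; _≢_; refl; sym; trans; cong; cong₂; subst; subst₂; module ≡-Reasoning)
open import Relation.Binary.Structures using (IsStrictTotalOrder)
open import Relation.Nullary.Decidable.Core using (Dec; yes; no; recompute; decidable-stable)
open import Relation.Nullary.Negation using (¬_; contradiction)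
open import Relation.Unary using (Pred; _∈_; _∉_; _⊆_; _≐_; _≬_; _∪_; ｛_｝)
open import Defs

private
  variable
    a b p q r ℓ : Level
    A : Set a
    B : Set b

-- Least natural numbers and identities of `xor`.

Least : Pred ℕ p → Pred ℕ p
Least P k = k ∈ P × (∀ {i} → i ℕ.< k → i ∉ P)

least-unique : ∀ {P : Pred ℕ p} {i j} → i ∈ Least P → j ∈ Least P → i ≡ j
least-unique {i = i} {j} (i∈P , i-least) (j∈P , j-least) with ℕ.<-cmp i j
... | tri< i<j _ _ = contradiction i∈P (j-least i<j)
... | tri≈ _ i≡j _ = i≡j
... | tri> _ _ j<i = contradiction j∈P (i-least j<i)

xor-swap : ∀ x y z → x xor (y xor z) ≡ y xor (x xor z)
xor-swap x y z = begin
  x xor (y xor z) ≡⟨ xor-assoc x y z ⟨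
  (x xor y) xor z ≡⟨ cong (_xor z) (xor-comm x y) ⟩
  (y xor x) xor z ≡⟨ xor-assoc y x z ⟩
  y xor (x xor z) ∎
  where open ≡-Reasoning

xor-cancel : ∀ x y → x xor (x xor y) ≡ y
xor-cancel x y = trans (sym (xor-assoc x x y)) (cong (_xor y) (xor-same x))

-- Finite and countable sets under excluded middle.

module Classical (em : ∀ ℓ → ExcludedMiddle ℓ) where

  dec : (P : Set p) → Dec P
  dec P = em _

  ¬¬-elim : {P : Set p} → ¬ ¬ P → P
  ¬¬-elim = decidable-stable (dec _)

  least : (P : Pred ℕ p) → ∃ P → ∃ (Least P)
  least P (n , n∈P) = ℕ.<-rec (λ n → n ∈ P → ∃ (Least P)) step n n∈P
    where
    step : ∀ n → (∀ {m} → m ℕ.< n → m ∈ P → ∃ (Least P)) → n ∈ P → ∃ (Least P)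
    step n rec n∈P with dec (∃[ m ] m ℕ.< n × m ∈ P)
    ... | yes (m , m<n , m∈P) = rec m<n m∈P
    ... | no  none            = n , n∈P , λ i<n i∈P → none (_ , i<n , i∈P)

  -- Inverts the code `f`: `e k` is a member with code `k` if there is one, and the default member
  -- fills the gaps.
  enumerate : {_≈_ : Rel A ℓ} {P : Pred A p} → CountableUpTo _≈_ P → ∃ P →
              Σ[ e ∈ (ℕ → A) ] (∀ k → e k ∈ P) × (∀ {x} → x ∈ P → ∃[ k ] e k ≈ x)
  enumerate {A = A} {P = P} (f , f-≈) default = proj₁ ∘ pick , proj₂ ∘ pick , λ {x} → hit x
    where
    pick : ℕ → ∃ P
    pick k with dec (∃[ x ] x ∈ P × f x ≡ k)
    ... | yes (x , x∈P , _) = x , x∈P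
    ... | no  _             = default

    code : ∀ {x} → x ∈ P → f (proj₁ (pick (f x))) ≡ f x
    code {x} x∈P with dec (∃[ y ] y ∈ P × f y ≡ f x)
    ... | yes (_ , _ , eq) = eq
    ... | no  none         = contradiction (x , x∈P , refl) none

    hit : ∀ x → x ∈ P → ∃[ k ] _
    hit x x∈P = f x , Equivalence.from (f-≈ (proj₂ (pick (f x))) x∈P) (code x∈P)

  finite-⊆ : {P : Pred A p} {Q : Pred A q} → P ⊆ Q → Finite Q → Finite P
  finite-⊆ {P = P} P⊆Q (xs , Q⊆xs , _) =
    filter P? xs , (λ x∈P → ∈-filter⁺ P? (Q⊆xs (P⊆Q x∈P)) x∈P) , proj₂ ∘ ∈-filter⁻ P? {xs = xs}
    where
    P? : ∀ x → Dec (P x)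
    P? x = dec (P x)

  finite-∪ : {P : Pred A p} {Q : Pred A q} → Finite P → Finite Q → Finite (P ∪ Q)
  finite-∪ (xs , P⊆ , ⊆P) (ys , Q⊆ , ⊆Q) =
    xs ++ ys , [ ∈-++⁺ˡ ∘ P⊆ , ∈-++⁺ʳ xs ∘ Q⊆ ]′ , λ z∈ → [ inj₁ ∘ ⊆P , inj₂ ∘ ⊆Q ]′ (∈-++⁻ xs z∈)

  finite-subsingleton : {P : Pred A p} → (∀ {x y} → x ∈ P → y ∈ P → x ≡ y) → Finite P
  finite-subsingleton {P = P} unique with dec (∃ P)
  ... | yes (x , x∈P) = x ∷ [] , (λ y∈P → here (unique y∈P x∈P)) , λ { (here refl) → x∈P }
  ... | no  empty     = [] , (λ x∈P → contradiction (_ , x∈P) empty) , λ ()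

  finite-⋃ : {P : Pred A p} {R : A → Pred B r} → Finite P → (∀ {x} → x ∈ P → Finite (R x)) →
             Finite (λ y → ∃[ x ] x ∈ P × y ∈ R x)
  finite-⋃ {A = A} {R = R} (xs , P⊆ , ⊆P) R-finite =
    finite-⊆ (λ { (x , x∈P , y∈Rx) → x , P⊆ x∈P , y∈Rx }) (over xs (R-finite ∘ ⊆P))
    where
    over : ∀ xs → (∀ {x} → x ∈ˡ xs → Finite (R x)) → Finite (λ y → ∃[ x ] x ∈ˡ xs × y ∈ R x)
    over []       _   = [] , (λ { (_ , () , _) }) , λ ()
    over (x ∷ xs) fin = finite-⊆
      (λ { (_ , here refl , y∈) → inj₁ y∈ ; (_ , there x∈ , y∈) → inj₂ (_ , x∈ , y∈) })
      (finite-∪ (fin (here refl)) (over xs (fin ∘ there)))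

  finite-preimage : {P : Pred B p} {f : A → B} → Injective _≡_ _≡_ f → Finite P → Finite (P ∘ f)
  finite-preimage {f = f} f-injective P-finite = finite-⊆ (λ fx∈P → _ , fx∈P , refl)
    (finite-⋃ P-finite λ {y} _ →
      finite-subsingleton {P = λ x → f x ≡ y} λ fx≡y fz≡y → f-injective (trans fx≡y (sym fz≡y)))

  finite-< : ∀ k → Finite (ℕ._< k)
  finite-< k = upTo k , ∈-upTo⁺ , ∈-upTo⁻

linked-tabulate : {R : Rel A ℓ} → Transitive R → ∀ {n} {f : Fin n → A} →
                  Linked R (tabulate f) → ∀ {i j} → i Fin.< j → R (f i) (f j)
linked-tabulate {R = R} R-trans {f = f} linked {i} {j} i<j =
  subst₂ R (lookup∘tabulate f i) (lookup∘tabulate f j) (Linked.lookup⁺ R-trans linked i<j)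

Fin-+-elim : ∀ {m n} (P : Pred (Fin (m + n)) p) → (∀ i → P (i ↑ˡ n)) → (∀ j → P (m ↑ʳ j)) → ∀ k → P k
Fin-+-elim {m = m} {n} P left right k = subst P (Fin.join-splitAt m n k) (go (splitAt m k))
  where
  go : ∀ s → P (join m n s)
  go (inj₁ i) = left i
  go (inj₂ j) = right j

-- Bits and parities of nodes.

module Construction
  (em : ∀ ℓ → ExcludedMiddle ℓ) {Ω : Set} {_<_ : Rel Ω 0ℓ} (isω₁ : Isω₁ _<_) where

  open Classical em
  open Trees _<_
  open Isω₁ isω₁
  open IsStrictTotalOrder isStrictTotalOrder using (compare; irrefl)

  private
    variable
      ξ η α β γ : Ω
      x y : Node
      H : List Ω

  Colouring : Set
  Colouring = Node → Bool

  Below : Ω → Pred Node 0ℓ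
  Below α x = ht x < α

  <-irrefl : ¬ (α < α)
  <-irrefl = irrefl refl

  <-≮-trans : α < β → ¬ (γ < β) → α < γ
  <-≮-trans {α = α} {γ = γ} α<β γ≮β with compare α γ
  ... | tri< α<γ _ _  = α<γ
  ... | tri≈ _ refl _ = contradiction α<β γ≮β
  ... | tri> _ _ γ<α  = contradiction (<-trans γ<α α<β) γ≮β

  -- The value x(ξ), with the junk value false when ξ is not in the domain of x.
  bit : Ω → Colouring
  bit ξ x with dec (ξ < ht x)
  ... | yes ξ<ht = x ⟨ ξ<ht ⟩
  ... | no  _    = false

  bit-⟨⟩ : (ξ<ht : ξ < ht x) → bit ξ x ≡ x ⟨ ξ<ht ⟩
  bit-⟨⟩ {ξ = ξ} {x} ξ<ht with dec (ξ < ht x)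
  ... | yes _    = refl
  ... | no  ξ≮ht = contradiction ξ<ht ξ≮ht

  bit-junk : ¬ (ξ < ht x) → bit ξ x ≡ false
  bit-junk {ξ = ξ} {x} ξ≮ht with dec (ξ < ht x)
  ... | yes ξ<ht = contradiction ξ<ht ξ≮ht
  ... | no  _    = refl

  AgreeBelow-bit : ∀ {s t} → AgreeBelow s t α → ξ < α → ξ < ht s → ξ < ht t → bit ξ s ≡ bit ξ t
  AgreeBelow-bit agree ξ<α p q = trans (bit-⟨⟩ p) (trans (agree ξ<α p q) (sym (bit-⟨⟩ q)))

  <S-bit : x <S y → ξ < ht x → bit ξ x ≡ bit ξ y
  <S-bit (x<y , agree) ξ<x = AgreeBelow-bit agree ξ<x ξ<x (<-trans ξ<x x<y)

  <S-trans : Transitive _<S_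
  <S-trans (x<y , agree) (y<z , agree′) = <-trans x<y y<z , λ ξ<x p q →
    trans (agree ξ<x p (<-trans ξ<x x<y)) (agree′ (<-trans ξ<x x<y) (<-trans ξ<x x<y) q)

  -- The parity of the number of elements ξ of H with x(ξ) = 1; repetitions in H are not counted.
  parity : List Ω → Colouring
  parity []      x = false
  parity (η ∷ H) x with dec (η ∈ˡ H)
  ... | yes _ = parity H x
  ... | no  _ = bit η x xor parity H x

  parity-cong : (∀ {η} → η ∈ˡ H → bit η x ≡ bit η y) → parity H x ≡ parity H y
  parity-cong {H = []}    same = refl
  parity-cong {H = η ∷ H} same with dec (η ∈ˡ H)
  ... | yes _ = parity-cong (same ∘ there)
  ... | no  _ = cong₂ _xor_ (same (here refl)) (parity-cong (same ∘ there))

  -- The summand `bit ξ` cancels the single contribution of `ξ` to the parity, and the other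
  -- ordinals contribute equally to both nodes. Counting `ξ` once is essential, since different
  -- families may split at the same height.
  parity-flip : ξ ∈ˡ H → (∀ {η} → η ∈ˡ H → η ≢ ξ → bit η x ≡ bit η y) →
                bit ξ x xor parity H x ≡ bit ξ y xor parity H y
  parity-flip {H = η ∷ H} ξ∈ same with dec (η ∈ˡ H)
  parity-flip {H = η ∷ H} (here refl) same | yes η∈H = parity-flip η∈H (same ∘ there)
  parity-flip {H = η ∷ H} (there ξ∈H) same | yes _   = parity-flip ξ∈H (same ∘ there)
  parity-flip {H = η ∷ H} {x} {y} (here refl) same | no η∉H = begin
    bit η x xor (bit η x xor parity H x) ≡⟨ xor-cancel (bit η x) _ ⟩
    parity H x                           ≡⟨ parity-cong (λ ζ∈H → same (there ζ∈H) λ { refl → η∉H ζ∈H }) ⟩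
    parity H y                           ≡⟨ xor-cancel (bit η y) _ ⟨
    bit η y xor (bit η y xor parity H y) ∎
    where open ≡-Reasoning
  parity-flip {ξ = ξ} {H = η ∷ H} {x} {y} (there ξ∈H) same | no η∉H = begin
    bit ξ x xor (bit η x xor parity H x) ≡⟨ xor-swap (bit ξ x) (bit η x) _ ⟩
    bit η x xor (bit ξ x xor parity H x) ≡⟨ cong₂ _xor_ (same (here refl) λ { refl → η∉H ξ∈H }) (parity-flip ξ∈H (same ∘ there)) ⟩
    bit η y xor (bit ξ y xor parity H y) ≡⟨ xor-swap (bit η y) (bit ξ y) _ ⟩
    bit ξ y xor (bit η y xor parity H y) ∎
    where open ≡-Reasoning

  linked-<S : ∀ {n} (f : Fin n → Node) → Linked _<S_ (tabulate f) → ∀ {i j} → i Fin.< j → f i <S f j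
  linked-<S f = linked-tabulate {R = _<S_} (λ {x} {y} {z} → <S-trans {x} {y} {z}) {f = f}

  linked-bit : ∀ {n} (f : Fin n → Node) → Linked _<S_ (tabulate f) →
               ∀ i j → ξ < ht (f i) → ξ < ht (f j) → bit ξ (f i) ≡ bit ξ (f j)
  linked-bit f linked i j ξ<i ξ<j with Fin.<-cmp i j
  ... | tri< i<j _ _  = <S-bit {f i} {f j} (linked-<S f linked i<j) ξ<i
  ... | tri≈ _ refl _ = refl
  ... | tri> _ _ j<i  = sym (<S-bit {f j} {f i} (linked-<S f linked j<i) ξ<j)

  linked-ht : ∀ {n} (f : Fin n → Node) → Linked _<S_ (tabulate f) →
              ∀ {i j} → i Fin.≤ j → ξ < ht (f i) → ξ < ht (f j)
  linked-ht f linked {i} {j} i≤j ξ<i with Fin.<-cmp i j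
  ... | tri< i<j _ _  = <-trans ξ<i (proj₁ (linked-<S f linked i<j))
  ... | tri≈ _ refl _ = ξ<i
  ... | tri> _ _ j<i  = contradiction i≤j (ℕ.<⇒≱ j<i)

  -- Finite sets whose halves differ at a single height.

  module _ (S : Pred Node 0ℓ) where
    open Families S

    ⟦⟧⊆S : ∀ b → ⟦ b ⟧ ⊆ S
    ⟦⟧⊆S (_ , a) (i , refl) = El-∈ (a ! i)
      where
      El-∈ : ∀ (t : El) → value t ∈ S
      -- The stored membership proof is irrelevant; excluded middle recovers a usable one.
      El-∈ (_ , [ t∈S ]) = recompute (dec _) t∈S

    -- What is used of membership in 𝒳_{s,n}, where ξ = ht(s).
    record Flips (ξ : Ω) (b : [S]^<ω) : Set where
      field
        above    : x ∈ ⟦ b ⟧ → ξ < ht x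
        agree    : x ∈ ⟦ b ⟧ → y ∈ ⟦ b ⟧ → η ≢ ξ → η < ht x → η < ht y → bit η x ≡ bit η y
        distinct : ∃[ x ] ∃[ y ] x ∈ ⟦ b ⟧ × y ∈ ⟦ b ⟧ × bit ξ x ≢ bit ξ y

    -- If the heights differed, `agree` for `η` would apply at `ξ` and contradict the pair that
    -- `distinct` provides there.
    Flips-unique : ∀ {b} → Flips ξ b → Flips η b → ξ ≡ η
    Flips-unique flipsξ flipsη = ¬¬-elim λ ξ≢η →
      let x , y , x∈ , y∈ , differ = Flips.distinct flipsξ in
      differ (Flips.agree flipsη x∈ y∈ ξ≢η (Flips.above flipsξ x∈) (Flips.above flipsξ y∈))

    linked-above : ∀ {s s′ i n} (f : Fin n → Node) → IsExtensionBy s i s′ → Linked _<S_ (s′ ∷ tabulate f) →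
                   ∀ j → ht s < ht (f j) × bit (ht s) (f j) ≡ i
    linked-above {s} {s′} f ext linked j = <-trans s<s′ (proj₁ s′<fj) ,
      trans (sym (<S-bit {s′} {f j} s′<fj s<s′)) (trans (bit-⟨⟩ s<s′) (IsExtensionBy.top ext s<s′))
      where
      s<s′ : ht s < ht s′
      s<s′ = Equivalence.from (IsExtensionBy.domain ext) (inj₂ refl)
      s′<fj : s′ <S f j
      s′<fj = linked-<S (λ { zero → s′ ; (suc j) → f j }) linked z<s

    𝒳-bits : ∀ {s n} .{{_ : NonZero n}} (a : [S]^ (n + n)) → 𝒳 s n (n + n , a) → ∀ j →
             bit (ht s) (value (a ! (j ↑ˡ n))) ≡ false × bit (ht s) (value (a ! (n ↑ʳ j))) ≡ true
    𝒳-bits {n = n} a (mk .a ext₀ linked₀ ext₁ linked₁ _ _) j =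
      proj₂ (linked-above (λ j → value (a ! (j ↑ˡ n))) ext₀ linked₀ j) ,
      proj₂ (linked-above (λ j → value (a ! (n ↑ʳ j))) ext₁ linked₁ j)

    𝒳-flips : ∀ {s} n .{{_ : NonZero n}} {b} → 𝒳 s n b → Flips (ht s) b
    𝒳-flips {s} n@(suc m) (mk a ext₀ linked₀ ext₁ linked₁ last<first D≐) = record
      { above    = λ { (i , refl) → Fin-+-elim (λ i → ht s < ht (value (a ! i)))
                       (proj₁ ∘ linked-above lower ext₀ linked₀) (proj₁ ∘ linked-above upper ext₁ linked₁) i }
      ; agree    = λ { (i , refl) (j , refl) η≢ → agree η≢ i j }
      ; distinct = lower zero , upper zero , (zero ↑ˡ n , refl) , (n ↑ʳ zero , refl) , λ same →
          case trans (sym (proj₂ (linked-above lower ext₀ linked₀ zero)))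
                     (trans same (proj₂ (linked-above upper ext₁ linked₁ zero))) of λ ()
      }
      where
      lower upper : Fin n → Node
      lower j = value (a ! (j ↑ˡ n))
      upper j = value (a ! (n ↑ʳ j))

      -- The comparison passes through `a(n-1)` and `a(n)`. Heights increase along the lower half
      -- and from `a(n-1)` to `a(n)`, so `η` lies in both domains, where `D≐` allows a difference
      -- only at `ht s`.
      crossing : η ≢ ht s → ∀ i j → η < ht (lower i) → η < ht (upper j) → bit η (lower i) ≡ bit η (upper j)
      crossing {η = η} η≢ i j η<i η<j = begin
        bit η (lower i)          ≡⟨ linked-bit lower (Linked.tail linked₀) i (fromℕ m) η<i η<last ⟩
        bit η (lower (fromℕ m))  ≡⟨ bit-⟨⟩ η<last ⟩
        lower (fromℕ m) ⟨ η<last ⟩ ≡⟨ decidable-stable (_ ≟ᵇ _) (λ differ → η≢ (sym (proj₁ D≐ (η<last , η<first , differ)))) ⟩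
        upper zero ⟨ η<first ⟩   ≡⟨ bit-⟨⟩ η<first ⟨
        bit η (upper zero)       ≡⟨ linked-bit upper (Linked.tail linked₁) zero j η<first η<j ⟩
        bit η (upper j)          ∎
        where
        open ≡-Reasoning
        η<last : η < ht (lower (fromℕ m))
        η<last = linked-ht lower (Linked.tail linked₀) (Fin.≤fromℕ i) η<i
        η<first : η < ht (upper zero)
        η<first = <-trans η<last last<first

      agree : η ≢ ht s → ∀ i j → η < ht (value (a ! i)) → η < ht (value (a ! j)) →
              bit η (value (a ! i)) ≡ bit η (value (a ! j))
      agree {η = η} η≢ = Fin-+-elim (λ i → ∀ j → η < ht (value (a ! i)) → η < ht (value (a ! j)) → _)
        (λ i → Fin-+-elim (λ j → η < ht (lower i) → η < ht (value (a ! j)) → _)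
          (λ j → linked-bit lower (Linked.tail linked₀) i j)
          (λ j → crossing η≢ i j))
        (λ i → Fin-+-elim (λ j → η < ht (upper i) → η < ht (value (a ! j)) → _)
          (λ j p q → sym (crossing η≢ j i q p))
          (λ j → linked-bit upper (Linked.tail linked₁) i j))

    -- For `b` in `𝒳 s n` and `ξ = ht s` the bits are `false` on the lower half and `true` on the
    -- upper one. Equality of the sums then says that `g` is constant on each half, with opposite
    -- values, without naming the halves.
    Splits : Ω → Colouring → Pred [S]^<ω 0ℓ
    Splits ξ g b = ∀ {x y} → x ∈ ⟦ b ⟧ → y ∈ ⟦ b ⟧ → bit ξ x xor g x ≡ bit ξ y xor g y

    Unsplit : Ω → Colouring → Family → Ω → Pred [S]^<ω 0ℓ
    Unsplit α g 𝒜 ξ b = b ∈ 𝒜 × ⟦ b ⟧ ⊆ Below α × ¬ Splits ξ g b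

    -- The invariant of the recursion and finiteness from non-overlapping.

    module _ (𝓕 : Pred Family 0ℓ) (kurepa : Is2ThinKurepa 𝓕) where
      open Is2ThinKurepa kurepa

      record Good (α : Ω) (g : ∀ {β} → β < α → Colouring) (h : Colouring) : Set₁ where
        field
          coherent : ∀ {β} (β<α : β < α) → Finite (λ x → ht x < β × g β<α x ≢ h x)
          splits   : ∀ {𝒜} → 𝒜 ∈ 𝓕 → (∀ {b} → b ∈ 𝒜 → Flips ξ b) → Finite (Unsplit α h 𝒜 ξ)

      -- Distinct members of a non-overlapping family are disjoint, so each node of `P` accounts for
      -- at most one of them.
      finite-meeting : ∀ {𝒜} {P : Pred Node p} → 𝒜 ∈ 𝓕 → Finite P → Finite (λ b → b ∈ 𝒜 × ⟦ b ⟧ ≬ P)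
      finite-meeting {𝒜 = 𝒜} 𝒜∈𝓕 P-finite = finite-⊆
        (λ { (b∈𝒜 , x , x∈b , x∈P) → x , x∈P , b∈𝒜 , x∈b })
        (finite-⋃ P-finite λ {x} _ → finite-subsingleton {P = λ b → b ∈ 𝒜 × x ∈ ⟦ b ⟧} shared)
        where
        shared : ∀ {x b b′} → b ∈ 𝒜 × x ∈ ⟦ b ⟧ → b′ ∈ 𝒜 × x ∈ ⟦ b′ ⟧ → b ≡ b′
        shared (b∈𝒜 , x∈b) (b′∈𝒜 , x∈b′) = ¬¬-elim λ b≢b′ → case nonOverlapping 𝒜∈𝓕 b∈𝒜 b′∈𝒜 b≢b′ of λ
          { (inj₁ b<b′) → <-irrefl (b<b′ x∈b x∈b′)
          ; (inj₂ b′<b) → <-irrefl (b′<b x∈b x∈b′)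
          }

      -- There is at most one such member: the lower of two would lie below an element of the other
      -- that is itself below `β`.
      finite-crossing : ∀ {𝒜} → 𝒜 ∈ 𝓕 → ∀ β →
        Finite (λ b → b ∈ 𝒜 × ⟦ b ⟧ ≬ Below β × ¬ (⟦ b ⟧ ⊆ Below β))
      finite-crossing 𝒜∈𝓕 β = finite-subsingleton λ
        { (b∈𝒜 , (x , x∈b , x<β) , b⊈β) (b′∈𝒜 , (x′ , x′∈b′ , x′<β) , b′⊈β) →
          ¬¬-elim λ b≢b′ → case nonOverlapping 𝒜∈𝓕 b∈𝒜 b′∈𝒜 b≢b′ of λ
            { (inj₁ b<b′) → b⊈β λ y∈b → <-trans (b<b′ y∈b x′∈b′) x′<β
            ; (inj₂ b′<b) → b′⊈β λ y∈b′ → <-trans (b′<b x∈b y∈b′) x<β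
            }
        }

      -- Extension to zero and to successors.

      module Extension (g : Ω → Colouring) {α : Ω}
                       (good : ∀ {β} → β < α → Good β (λ {γ} _ → g γ) (g β)) where

        Extends : Colouring → Set₁
        Extends = Good α (λ {β} _ → g β)

        coherent-below : β < α → γ < α → Finite (λ x → ht x < β × ht x < γ × g β x ≢ g γ x)
        coherent-below {β} {γ} β<α γ<α with compare β γ
        ... | tri< β<γ _ _  = finite-⊆ (λ (x<β , _ , differ) → x<β , differ) (Good.coherent (good γ<α) β<γ)
        ... | tri≈ _ refl _ = finite-subsingleton λ (_ , _ , differ) → contradiction refl differ
        ... | tri> _ _ γ<β  = finite-⊆ (λ (_ , x<γ , differ) → x<γ , differ ∘ sym) (Good.coherent (good β<α) γ<β)

        extend-zero : ¬ ∃ (_< α) → ∃ Extends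
        extend-zero empty = (λ _ → false) , record
          { coherent = λ β<α → contradiction (_ , β<α) empty
          ; splits   = λ 𝒜∈𝓕 flips → finite-subsingleton λ (b∈𝒜 , b⊆α , _) →
              contradiction (_ , b⊆α (proj₁ (proj₂ (proj₂ (Flips.distinct (flips b∈𝒜)))))) empty
          }

        extend-suc : β < α → (∀ {γ} → γ < α → ¬ (β < γ)) → ∃ Extends
        extend-suc {β} β<α max = g β , record
          { coherent = λ γ<α → finite-⊆ (λ (x<γ , differ) → x<γ , <-≮-trans x<γ (max γ<α) , differ)
              (coherent-below γ<α β<α)
          ; splits   = λ {ξ} {𝒜} 𝒜∈𝓕 flips → finite-⊆
              (λ {b} (b∈𝒜 , b⊆α , unsplit) → case dec (⟦ b ⟧ ⊆ Below β) of λ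
                { (yes b⊆β) → inj₁ (b∈𝒜 , b⊆β , unsplit)
                ; (no  b⊈β) → inj₂ (b∈𝒜 , b⊆α , b⊈β)
                })
              (finite-∪ (Good.splits (good β<α) 𝒜∈𝓕 flips) (at-top 𝒜∈𝓕 flips))
          }
          where
          -- Of two such members, the lower one lies below an element of the other. That element has
          -- height at most `β`, so the lower member would be contained in `Below β`.
          at-top : ∀ {𝒜} → 𝒜 ∈ 𝓕 → (∀ {b} → b ∈ 𝒜 → Flips ξ b) →
                   Finite (λ b → b ∈ 𝒜 × ⟦ b ⟧ ⊆ Below α × ¬ (⟦ b ⟧ ⊆ Below β))
          at-top 𝒜∈𝓕 flips = finite-subsingleton λ
            { {b} {b′} (b∈𝒜 , b⊆α , b⊈β) (b′∈𝒜 , b′⊆α , b′⊈β) →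
              let x  , _ , x∈b   , _ = Flips.distinct (flips b∈𝒜)
                  x′ , _ , x′∈b′ , _ = Flips.distinct (flips b′∈𝒜) in
              ¬¬-elim λ b≢b′ → case nonOverlapping 𝒜∈𝓕 b∈𝒜 b′∈𝒜 b≢b′ of λ
                { (inj₁ b<b′) → b⊈β  λ y∈b  → <-≮-trans (b<b′ y∈b x′∈b′) (max (b′⊆α x′∈b′))
                ; (inj₂ b′<b) → b′⊈β λ y∈b′ → <-≮-trans (b′<b x∈b y∈b′) (max (b⊆α x∈b))
                }
            }

        -- Limit stages: representatives of the traces.

        module Limit {β₀ : Ω} (β₀<α : β₀ < α) (cofinal : ∀ {β} → β < α → ∃[ γ ] β < γ × γ < α)
                     {𝒜₀ : Family} (𝒜₀∈𝓕 : 𝒜₀ ∈ 𝓕) where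

          trace : Family → Family
          trace 𝒜 b = b ∈ 𝒜 × ⟦ b ⟧ ⊆ S ↾ α

          enum-below = enumerate (segmentsCountable α) (β₀ , β₀<α)
          enum-traces = enumerate (thin α) (trace 𝒜₀ , 𝒜₀ , 𝒜₀∈𝓕 , id , id)

          δ : ℕ → Ω
          δ = proj₁ enum-below

          δ<α : ∀ k → δ k < α
          δ<α = proj₁ (proj₂ enum-below)

          𝒜 : ℕ → Family
          𝒜 k = proj₁ (proj₁ (proj₂ enum-traces) k)

          𝒜∈𝓕 : ∀ k → 𝒜 k ∈ 𝓕
          𝒜∈𝓕 k = proj₁ (proj₂ (proj₁ (proj₂ enum-traces) k))

          -- Thinness allows countably many representatives. The representative of `ℬ` may differ
          -- from it from `α` on, but has the same members below `α`.
          𝒜-trace : ∀ {ℬ} → ℬ ∈ 𝓕 → ∃[ k ] (∀ {b} → b ∈ ℬ → ⟦ b ⟧ ⊆ Below α → b ∈ 𝒜 k)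
          𝒜-trace {ℬ} ℬ∈𝓕 =
            let k , 𝒞≐ = proj₂ (proj₂ enum-traces) (ℬ , ℬ∈𝓕 , id , id) in
            k , λ {b} b∈ℬ b⊆α → proj₁ (proj₁ (proj₂ (proj₂ (proj₁ (proj₂ enum-traces) k)))
              (proj₂ 𝒞≐ (b∈ℬ , λ x∈b → ⟦⟧⊆S b x∈b , b⊆α x∈b)))

          ζ : ℕ → Ω
          ζ k = ht (proj₁ (families (𝒜∈𝓕 k)))

          flips : ∀ k {b} → b ∈ 𝒜 k → Flips (ζ k) b
          flips k b∈𝒜 with families (𝒜∈𝓕 k)
          ... | _ , _ , n , n≢0 , 𝒜⊆𝒳 , _ = 𝒳-flips n {{n≢0}} (𝒜⊆𝒳 b∈𝒜)

          abstract
            -- Entries not below `α` are ignored, so heights not known to be below `α` may be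
            -- listed. Strictness comes from `cofinal`.
            bound : (us : List Ω) → ∃[ γ ] γ < α × (∀ {ξ} → ξ ∈ˡ us → ξ < α → ξ < γ)
            bound []       = β₀ , β₀<α , λ ()
            bound (ξ ∷ us) with bound us | dec (ξ < α)
            ... | γ , γ<α , us<γ | no ξ≮α = γ , γ<α , λ
              { (here refl) ξ<α → contradiction ξ<α ξ≮α ; (there ξ∈us) → us<γ ξ∈us }
            ... | γ , γ<α , us<γ | yes ξ<α with compare ξ γ
            ...   | tri< ξ<γ _ _ = γ , γ<α , λ { (here refl) _ → ξ<γ ; (there ξ∈us) → us<γ ξ∈us }
            ...   | tri≈ _ refl _ = let ε , γ<ε , ε<α = cofinal γ<α in
              ε , ε<α , λ { (here refl) _ → γ<ε ; (there ξ∈us) η<α → <-trans (us<γ ξ∈us η<α) γ<ε }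
            ...   | tri> _ _ γ<ξ = let ε , ξ<ε , ε<α = cofinal ξ<α in
              ε , ε<α , λ { (here refl) _ → ξ<ε ; (there ξ∈us) η<α → <-trans (us<γ ξ∈us η<α) (<-trans γ<ξ ξ<ε) }

          -- Bad members and their finite closures.

          Bad : Ω → ℕ → Pred [S]^<ω 0ℓ
          Bad γ m b = b ∈ 𝒜 m × ⟦ b ⟧ ⊆ Below α × ⟦ b ⟧ ≬ Below γ × ¬ (⟦ b ⟧ ⊆ Below γ × Splits (ζ m) (g γ) b)

          -- Goodness of `g γ` handles the members inside `Below γ`, and `finite-crossing` those
          -- that stick out.
          finite-Bad : γ < α → ∀ m → Finite (Bad γ m)
          finite-Bad {γ} γ<α m = finite-⊆
            (λ {b} (b∈𝒜 , _ , b≬γ , bad) → case dec (⟦ b ⟧ ⊆ Below γ) of λ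
              { (yes b⊆γ) → inj₁ (b∈𝒜 , b⊆γ , λ split → bad (b⊆γ , split))
              ; (no  b⊈γ) → inj₂ (b∈𝒜 , b≬γ , b⊈γ)
              })
            (finite-∪ (Good.splits (good γ<α) (𝒜∈𝓕 m) (flips m)) (finite-crossing (𝒜∈𝓕 m) γ))

          closure : ∀ k b → ∃[ a* ] IsCl ⟦ b ⟧ (applyUpTo 𝒜 k) a* × Finite a*
          closure k b = finiteClosure b (applyUpTo 𝒜 k) (applyUpTo⁺₂ 𝒜 k 𝒜∈𝓕)

          abstract
            -- Closures are taken of one bad member at a time, in the form `finiteClosure` accepts.
            -- Their union is still closed: a member that meets it meets one of the closures and
            -- lies inside that one.
            K : ℕ → Ω → Pred Node 0ℓ
            K k γ x = ∃[ m ] m ℕ.< k × ∃[ b ] b ∈ Bad γ m × x ∈ proj₁ (closure k b)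

            finite-K : ∀ k → γ < α → Finite (K k γ)
            finite-K k γ<α = finite-⋃ (finite-< k) λ {m} _ → finite-⋃ (finite-Bad γ<α m) λ {b} _ →
              proj₂ (proj₂ (closure k b))

            K-closed : ∀ {m k b} → m ℕ.< k → b ∈ 𝒜 m → ⟦ b ⟧ ≬ K k γ → ⟦ b ⟧ ⊆ K k γ
            K-closed {k = k} m<k b∈𝒜 (x , x∈b , i , i<k , c , c-bad , x∈cl)
              with IsCl.closed (proj₁ (proj₂ (closure k c))) (∈-applyUpTo⁺ 𝒜 m<k) b∈𝒜
            ... | inj₁ b⊥cl = contradiction (x∈b , x∈cl) b⊥cl
            ... | inj₂ b⊆cl = λ y∈b → i , i<k , c , c-bad , b⊆cl y∈b

            Bad⊆K : ∀ {m k b} → m ℕ.< k → b ∈ Bad γ m → ⟦ b ⟧ ⊆ K k γ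
            Bad⊆K {m = m} {k} {b} m<k b-bad x∈b =
              m , m<k , b , b-bad , IsCl.contains (proj₁ (proj₂ (closure k b))) x∈b

          -- The heights of K k (θ k) are targets so that the sets of nodes coloured by stage k increase with k.
          stage : ℕ → ∃ (_< α)
          targets : ℕ → List Ω
          stage k = let γ , γ<α , _ = bound (targets k) in γ , γ<α
          targets zero    = δ zero ∷ ζ zero ∷ []
          targets (suc k) = let γ , γ<α = stage k in
            δ (suc k) ∷ ζ (suc k) ∷ γ ∷ map ht (proj₁ (finite-K k γ<α))

          -- Cofinal stages and the nodes coloured by each.

          θ : ℕ → Ω
          θ k = proj₁ (stage k)

          θ<α : ∀ k → θ k < α
          θ<α k = proj₂ (stage k)

          <θ : ∀ k → ξ ∈ˡ targets k → ξ < α → ξ < θ k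
          <θ k = proj₂ (proj₂ (bound (targets k)))

          -- Makes the `θ k` cofinal in `α`, because `δ` enumerates the ordinals below `α`.
          δ<θ : ∀ k → δ k < θ k
          δ<θ zero    = <θ zero (here refl) (δ<α zero)
          δ<θ (suc k) = <θ (suc k) (here refl) (δ<α (suc k))

          -- A node not coloured by stage `k` has height at least `θ k`, so this puts `ζ k` into its
          -- domain.
          ζ<θ : ∀ k → ζ k < α → ζ k < θ k
          ζ<θ zero    = <θ zero (there (here refl))
          ζ<θ (suc k) = <θ (suc k) (there (here refl))

          Kθ : ℕ → Pred Node 0ℓ
          Kθ k = K k (θ k)

          -- The nodes coloured by stage k. As a set of nodes it increases with k and, below α, it
          -- contains every member of 𝒜 m (m < k) that it meets.
          T : Node → Pred ℕ 0ℓ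
          T x k = x ∈ Kθ k ⊎ ht x < θ k

          T-suc : ∀ {k} → ht x < α → k ∈ T x → suc k ∈ T x
          T-suc {k = k} x<α (inj₁ x∈K) = inj₂ (<θ (suc k)
            (there (there (there (∈-map⁺ ht (proj₁ (proj₂ (finite-K k (θ<α k))) x∈K))))) x<α)
          T-suc {k = k} x<α (inj₂ x<θ) = inj₂ (<-trans x<θ (<θ (suc k) (there (there (here refl))) (θ<α k)))

          T-mono : ∀ {i j} → ht x < α → i ℕ.≤ j → i ∈ T x → j ∈ T x
          T-mono {x} {i} x<α i≤j i∈T = go (ℕ.≤⇒≤′ i≤j)
            where
            go : ∀ {j} → i ℕ.≤′ j → j ∈ T x
            go (ℕ.≤′-reflexive refl) = i∈T
            go (ℕ.≤′-step i≤j)       = T-suc x<α (go i≤j)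

          T-≤θ : β < α → ∃[ k ] (∀ {x} → ht x < β → k ∈ T x)
          T-≤θ β<α = let k , δk≡β = proj₂ (proj₂ enum-below) β<α in
            k , λ x<β → inj₂ (<-trans x<β (subst (_< θ k) δk≡β (δ<θ k)))

          T-exhausts : ht x < α → ∃ (T x)
          T-exhausts x<α = let γ , x<γ , γ<α = cofinal x<α
                               k , below = T-≤θ γ<α in k , below x<γ

          -- If `x` is in `Kθ k`, closure brings `y` along. If `ht x < θ k`, then `b` either lies
          -- below `θ k` or is bad and hence inside `Kθ k`.
          T-closed : ∀ {m k b} → m ℕ.< k → b ∈ 𝒜 m → ⟦ b ⟧ ⊆ Below α →
                     x ∈ ⟦ b ⟧ → y ∈ ⟦ b ⟧ → k ∈ T x → k ∈ T y
          T-closed m<k b∈𝒜 b⊆α x∈b y∈b (inj₁ x∈K) = inj₁ (K-closed m<k b∈𝒜 (_ , x∈b , x∈K) y∈b)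
          T-closed {m = m} {k} {b} m<k b∈𝒜 b⊆α x∈b y∈b (inj₂ x<θ)
            with dec (⟦ b ⟧ ⊆ Below (θ k) × Splits (ζ m) (g (θ k)) b)
          ... | yes (b⊆θ , _) = inj₂ (b⊆θ y∈b)
          ... | no  bad       = inj₁ (Bad⊆K m<k (b∈𝒜 , b⊆α , (_ , x∈b , x<θ) , bad) y∈b)

          -- The colouring at a limit.

          -- Parity takes precedence on `Kθ k` even below `θ k`, where `g (θ k)` may fail to split a
          -- bad member.
          local : ℕ → Colouring
          local k x with dec (x ∈ Kθ k)
          ... | yes _ = parity (applyUpTo ζ k) x
          ... | no  _ = g (θ k) x

          local-∈ : ∀ {k} → x ∈ Kθ k → local k x ≡ parity (applyUpTo ζ k) x
          local-∈ {x} {k} x∈K with dec (x ∈ Kθ k)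
          ... | yes _   = refl
          ... | no  x∉K = contradiction x∈K x∉K

          local-∉ : ∀ {k} → x ∉ Kθ k → local k x ≡ g (θ k) x
          local-∉ {x} {k} x∉K with dec (x ∈ Kθ k)
          ... | yes x∈K = contradiction x∈K x∉K
          ... | no  _   = refl

          h : Colouring
          h x with dec (∃ (Least (T x)))
          ... | yes (k , _) = local k x
          -- Not reached at nodes of height below `α`, which all have a least stage by `T-exhausts`.
          ... | no  _       = false

          h-local : ∀ {k} → k ∈ Least (T x) → h x ≡ local k x
          h-local {x} k-least with dec (∃ (Least (T x)))
          ... | yes (_ , least) = cong (λ k → local k x) (least-unique {P = T x} least k-least)
          ... | no  none        = contradiction (_ , k-least) none

          -- If `b` misses `Kθ k`, it is not bad, so `g (θ k)` splits it. Otherwise it lies inside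
          -- `Kθ k`, and `parity-flip` applies because the bits agree at every listed ordinal except
          -- `ζ m`.
          local-splits : ∀ {m k b} → m ℕ.< k → b ∈ 𝒜 m → ⟦ b ⟧ ⊆ Below α →
                         (∀ {x} → x ∈ ⟦ b ⟧ → k ∈ Least (T x)) → Splits (ζ m) (local k) b
          local-splits {m} {k} {b} m<k b∈𝒜 b⊆α k-least {x} {y} x∈b y∈b with dec (x ∈ Kθ k)
          ... | no x∉K = trans (proj₂ b-good x∈b y∈b) (cong (bit (ζ m) y xor_) (sym (local-∉ (b∩K=∅ y∈b))))
            where
            b∩K=∅ : ∀ {z} → z ∈ ⟦ b ⟧ → z ∉ Kθ k
            b∩K=∅ z∈b z∈K = x∉K (K-closed m<k b∈𝒜 (_ , z∈b , z∈K) x∈b)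
            b-good : ⟦ b ⟧ ⊆ Below (θ k) × Splits (ζ m) (g (θ k)) b
            b-good = ¬¬-elim λ bad → case proj₁ (k-least x∈b) of λ
              { (inj₁ x∈K) → x∉K x∈K
              ; (inj₂ x<θ) → x∉K (Bad⊆K m<k (b∈𝒜 , b⊆α , (_ , x∈b , x<θ) , bad) x∈b)
              }
          ... | yes x∈K = trans (parity-flip (∈-applyUpTo⁺ ζ m<k) same)
              (cong (bit (ζ m) y xor_) (sym (local-∈ (K-closed m<k b∈𝒜 (_ , x∈b , x∈K) y∈b))))
            where
            same : η ∈ˡ applyUpTo ζ k → η ≢ ζ m → bit η x ≡ bit η y
            same η∈ η≢ζ with ∈-applyUpTo⁻ ζ η∈
            ... | i , i<k , refl with dec (ζ i < α)
            ...   | yes ζ<α = Flips.agree (flips m b∈𝒜) x∈b y∈b η≢ζ (ζ<b x∈b) (ζ<b y∈b)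
              where
              ζ<b : ∀ {z} → z ∈ ⟦ b ⟧ → ζ i < ht z
              -- Minimality of `k` excludes `ht z < θ i` for `i < k`, while `ζ i < θ i`.
              ζ<b z∈b = <-≮-trans (ζ<θ i ζ<α) (proj₂ (k-least z∈b) i<k ∘ inj₂)
            ...   | no ζ≮α = trans (junk x∈b) (sym (junk y∈b))
              where
              junk : ∀ {z} → z ∈ ⟦ b ⟧ → bit (ζ i) z ≡ false
              junk z∈b = bit-junk λ ζ<z → ζ≮α (<-trans ζ<z (b⊆α z∈b))

          -- All of `b` is first coloured at one common stage `k`. No element is coloured by stage
          -- `m`, and at each later stage `T-closed` colours all of `b` or none of it.
          h-splits : ∀ {m b} → b ∈ 𝒜 m → ⟦ b ⟧ ⊆ Below α → (∀ {x} → x ∈ ⟦ b ⟧ → m ∉ T x) → Splits (ζ m) h b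
          h-splits {m} {b} b∈𝒜 b⊆α b∩T=∅ {x} {y} x∈b y∈b = begin
            bit (ζ m) x xor h x       ≡⟨ cong (bit (ζ m) x xor_) (h-local (k-least x∈b)) ⟩
            bit (ζ m) x xor local k x ≡⟨ local-splits m<k b∈𝒜 b⊆α k-least x∈b y∈b ⟩
            bit (ζ m) y xor local k y ≡⟨ cong (bit (ζ m) y xor_) (h-local (k-least y∈b)) ⟨
            bit (ζ m) y xor h y       ∎
            where
            open ≡-Reasoning
            least-x = least (T x) (T-exhausts (b⊆α x∈b))
            k = proj₁ least-x
            m<k : m ℕ.< k
            m<k = ℕ.≰⇒> λ k≤m → b∩T=∅ x∈b (T-mono (b⊆α x∈b) k≤m (proj₁ (proj₂ least-x)))
            k-least : ∀ {z} → z ∈ ⟦ b ⟧ → k ∈ Least (T z)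
            k-least z∈b = T-closed m<k b∈𝒜 b⊆α x∈b z∈b (proj₁ (proj₂ least-x)) , λ {i} i<k i∈T →
              case i ℕ.≤? m of λ
                { (yes i≤m) → b∩T=∅ z∈b (T-mono (b⊆α z∈b) i≤m i∈T)
                ; (no  i≰m) → proj₂ (proj₂ least-x) i<k
                    (T-closed (ℕ.≰⇒> i≰m) b∈𝒜 b⊆α z∈b x∈b i∈T)
                }

          -- Some stage `k` colours every node below `β`, so only the stages `j ≤ k` matter. At
          -- stage `j`, outside the finite `Kθ j`, `h` is `g (θ j)`, which coheres with `g β`.
          h-coherent : β < α → Finite (λ x → ht x < β × g β x ≢ h x)
          h-coherent {β} β<α = finite-⊆ cover (finite-⋃ (finite-< (suc k)) λ {j} _ →
            finite-∪ (finite-K j (θ<α j)) (coherent-below β<α (θ<α j)))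
            where
            k = proj₁ (T-≤θ β<α)
            cover : ∀ {x} → ht x < β × g β x ≢ h x →
                    ∃[ j ] j ℕ.< suc k × (x ∈ Kθ j ⊎ ht x < β × ht x < θ j × g β x ≢ g (θ j) x)
            cover {x} (x<β , differ) with least (T x) (k , proj₂ (T-≤θ β<α) x<β)
            ... | j , j∈T , j-least = j , s≤s (ℕ.≮⇒≥ λ k<j → j-least k<j (proj₂ (T-≤θ β<α) x<β)) , place j∈T
              where
              place : j ∈ T x → x ∈ Kθ j ⊎ ht x < β × ht x < θ j × g β x ≢ g (θ j) x
              place _ with dec (x ∈ Kθ j)
              place _          | yes x∈K = inj₁ x∈K
              place (inj₁ x∈K) | no  _   = inj₁ x∈K
              place (inj₂ x<θ) | no  x∉K = inj₂ (x<β , x<θ , λ same →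
                differ (trans same (sym (trans (h-local (j∈T , j-least)) (local-∉ x∉K)))))

          -- Members that avoid stage `m` are split by `h-splits`. Of the others, finitely many meet
          -- `Kθ m` or are bad; the rest are split by `g (θ m)`, so an unsplit one contains one of
          -- the finitely many nodes where `h` differs from `g (θ m)`.
          h-almost-splits : ∀ m → Finite (Unsplit α h (𝒜 m) (ζ m))
          h-almost-splits m = finite-⊆ cover
            (finite-∪ (finite-meeting (𝒜∈𝓕 m) (finite-K m (θ<α m)))
            (finite-∪ (finite-Bad (θ<α m) m)
                      (finite-meeting (𝒜∈𝓕 m) (h-coherent (θ<α m)))))
            where
            Disagreement : Pred Node 0ℓ
            Disagreement x = ht x < θ m × g (θ m) x ≢ h x
            cover : ∀ {b} → b ∈ Unsplit α h (𝒜 m) (ζ m) →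
                    b ∈ 𝒜 m × ⟦ b ⟧ ≬ Kθ m ⊎ b ∈ Bad (θ m) m ⊎ b ∈ 𝒜 m × ⟦ b ⟧ ≬ Disagreement
            cover {b} (b∈𝒜 , b⊆α , unsplit) with dec (⟦ b ⟧ ≬ Kθ m) | dec (⟦ b ⟧ ≬ Below (θ m))
            ... | yes b≬K | _       = inj₁ (b∈𝒜 , b≬K)
            ... | no b∩K=∅ | no b∩θ=∅ = contradiction (λ {x} {y} → h-splits b∈𝒜 b⊆α
              (λ { z∈b (inj₁ z∈K) → b∩K=∅ (_ , z∈b , z∈K) ; z∈b (inj₂ z<θ) → b∩θ=∅ (_ , z∈b , z<θ) }) {x} {y}) unsplit
            ... | no _     | yes b≬θ with dec (⟦ b ⟧ ⊆ Below (θ m) × Splits (ζ m) (g (θ m)) b)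
            ...   | no  bad           = inj₂ (inj₁ (b∈𝒜 , b⊆α , b≬θ , bad))
            ...   | yes (b⊆θ , split) = inj₂ (inj₂ (b∈𝒜 , ¬¬-elim λ agreeing → unsplit λ {x} {y} x∈b y∈b →
              let same : ∀ {z} → z ∈ ⟦ b ⟧ → g (θ m) z ≡ h z
                  same z∈b = decidable-stable (_ ≟ᵇ _) λ differ → agreeing (_ , z∈b , b⊆θ z∈b , differ) in
              subst₂ (λ i j → bit (ζ m) x xor i ≡ bit (ζ m) y xor j) (same x∈b) (same y∈b) (split x∈b y∈b)))

          extend-limit : ∃ Extends
          extend-limit = h , record
            { coherent = h-coherent
            ; splits   = λ {ξ} {ℬ} ℬ∈𝓕 ℬ-flips →
                let k , ℬ⊆𝒜 = 𝒜-trace ℬ∈𝓕 in finite-⊆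
                  (λ {b} (b∈ℬ , b⊆α , unsplit) →
                    let b∈𝒜 = ℬ⊆𝒜 b∈ℬ b⊆α in
                    b∈𝒜 , b⊆α , λ split → unsplit
                      -- The common member `b` forces the height of the representative, `ζ k`, to
                      -- equal `ξ`.
                      (subst (λ ξ → Splits ξ h b) (Flips-unique (flips k b∈𝒜) (ℬ-flips b∈ℬ)) split))
                  (h-almost-splits k)
            }

        extend : ∃ 𝓕 → ∃ Extends
        extend (_ , 𝒜₀∈𝓕) with dec (∃ (_< α))
        ... | no empty = extend-zero empty
        ... | yes (_ , β₀<α) with dec (∃[ β ] β < α × (∀ {γ} → γ < α → ¬ (β < γ)))
        ...   | yes (_ , β<α , max) = extend-suc β<α max
        ...   | no  no-max = Limit.extend-limit β₀<α
          (λ {β} β<α → ¬¬-elim λ none → no-max (β , β<α , λ γ<α β<γ → none (_ , β<γ , γ<α))) 𝒜₀∈𝓕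

      -- Recursion along `Ω` and the colouring of pairs.

      module Recursion (ext : ∀ a b → Extensionality a b) (nonempty : ∃ 𝓕) where

        -- Values are chosen apart from the proof that they are good: `colouring-good` shows by a
        -- second induction that the default `false` is never taken.
        step : ∀ α → (∀ {β} → β < α → Colouring) → Colouring
        step α g with dec (∃ (Good α g))
        ... | yes (h , _) = h
        ... | no  _       = λ _ → false

        step-good : ∀ (g : ∀ {β} → β < α → Colouring) → ∃ (Good α g) → Good α g (step α g)
        step-good {α} g exists with dec (∃ (Good α g))
        ... | yes (_ , good) = good
        ... | no  none       = contradiction exists none

        colouring : Ω → Colouring
        colouring = WF.All.wfRec wellFounded 0ℓ (λ _ → Colouring) step

        -- Unfolding the recursion requires `step` to respect pointwise equal histories, which
        -- function extensionality provides.
        colouring-step : ∀ α → colouring α ≡ step α (λ {β} _ → colouring β)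
        colouring-step α = WF.FixPoint.unfold-wfRec wellFounded (λ _ → Colouring) step step-ext
          where
          step-ext : ∀ α {g g′ : ∀ {β} → β < α → Colouring} →
                     (∀ {β} (β<α : β < α) → g β<α ≡ g′ β<α) → step α g ≡ step α g′
          step-ext α {g} {g′} g≡g′ = cong (λ (g : ∀ {β} → β < α → Colouring) → step α g)
            (implicit-extensionality (ext _ _) {f = λ {β} → g {β}} {g = λ {β} → g′ {β}} λ {β} → ext _ _ g≡g′)

        colouring-good : ∀ α → Good α (λ {β} _ → colouring β) (colouring α)
        colouring-good = WF.All.wfRec wellFounded _ (λ α → Good α (λ {β} _ → colouring β) (colouring α))
          λ α good → subst (Good α (λ {β} _ → colouring β)) (sym (colouring-step α))
            (step-good (λ {β} _ → colouring β) (Extension.extend colouring good nonempty))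

        c : [S]^ 2 → Bool
        c a = colouring (ht (value (a ! suc zero))) (value (a ! zero))

        c-coherent : (s t : El) (s<t : value s <S value t) →
          Finite (λ x → Σ[ x<s ∈ value x <S value s ]
            c (⟪ x , s ⟫ (proj₁ x<s)) ≢ c (⟪ x , t ⟫ (<-trans (proj₁ x<s) (proj₁ s<t))))
        c-coherent s t s<t = finite-⊆ (λ (x<s , differ) → proj₁ x<s , differ)
          -- Coherence is a statement about nodes; injectivity of `value` carries finiteness over to
          -- `El`.
          (finite-preimage value-injective (Good.coherent (colouring-good (ht (value t))) (proj₁ s<t)))

        c-cross : ∀ {k m} (b : [S]^ k) (a : [S]^ m)
                  (b⊆ : ⟦ _ , b ⟧ ⊆ S ↾ α) (a⊆ : ⟦ _ , a ⟧ ⊆ level S α) (i : Fin k) (j : Fin m) →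
                  c (cross b a b⊆ a⊆ i j) ≡ colouring α (value (b ! i))
        c-cross b a b⊆ a⊆ i j = cong (λ α → colouring α (value (b ! i))) (proj₂ (a⊆ (j , refl)))

        c-homogeneous : ∀ α {s} n .{{_ : NonZero n}} (𝒜 : Family) → 𝒜 ∈ 𝓕 → 𝒜 ⊆ 𝒳 s n →
          ∀ {m} (a : [S]^ m) (a⊆ : ⟦ m , a ⟧ ⊆ level S α) (j₀ j₁ : Fin m) →
          Finite (λ (b : [S]^ (n + n)) → (n + n , b) ∈ 𝒜 × Σ[ b⊆ ∈ ⟦ n + n , b ⟧ ⊆ S ↾ α ]
            ¬ (Σ[ i ∈ Bool ] ∀ (j : Fin n) →
              c (cross b a b⊆ a⊆ (j ↑ˡ n) j₀) ≡ i × c (cross b a b⊆ a⊆ (n ↑ʳ j) j₁) ≡ not i))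
        c-homogeneous α {s} n@(suc _) 𝒜 𝒜∈𝓕 𝒜⊆𝒳 a a⊆ j₀ j₁ = finite-⊆
          (λ {b} (b∈𝒜 , b⊆ , inhomogeneous) → b∈𝒜 , (λ x∈b → proj₂ (b⊆ x∈b)) , λ split →
            inhomogeneous (homogeneous b b⊆ (𝒜⊆𝒳 b∈𝒜) split))
          (finite-preimage {f = λ b → n + n , b} (λ { refl → refl })
            (Good.splits (colouring-good α) 𝒜∈𝓕 (λ b∈𝒜 → 𝒳-flips n (𝒜⊆𝒳 b∈𝒜))))
          where
          homogeneous : ∀ (b : [S]^ (n + n)) (b⊆ : ⟦ n + n , b ⟧ ⊆ S ↾ α) → 𝒳 s n (n + n , b) → Splits (ht s) (colouring α) (n + n , b) →
            Σ[ i ∈ Bool ] ∀ (j : Fin n) →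
              c (cross b a b⊆ a⊆ (j ↑ˡ n) j₀) ≡ i × c (cross b a b⊆ a⊆ (n ↑ʳ j) j₁) ≡ not i
          -- The colour `i` is that of `b(0)`. Comparing with `b(0)` gives `i` where the bit is
          -- `false` and `not i` where it is `true`.
          homogeneous b b⊆ b∈𝒳 split = colouring α (lower zero) , λ j →
            trans (c-cross b a b⊆ a⊆ (j ↑ˡ n) j₀)
              (subst₂ (λ u v → u xor colouring α (lower j) ≡ v xor colouring α (lower zero))
                (proj₁ (𝒳-bits b b∈𝒳 j)) (proj₁ (𝒳-bits b b∈𝒳 zero))
                (split (j ↑ˡ n , refl) (zero ↑ˡ n , refl))) ,
            trans (c-cross b a b⊆ a⊆ (n ↑ʳ j) j₁) (trans (sym (not-involutive _)) (cong not
              (subst₂ (λ u v → u xor colouring α (upper j) ≡ v xor colouring α (lower zero))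
                (proj₂ (𝒳-bits b b∈𝒳 j)) (proj₁ (𝒳-bits b b∈𝒳 zero))
                (split (n ↑ʳ j , refl) (zero ↑ˡ n , refl)))))
            where
            lower upper : Fin n → Node
            lower j = value (b ! (j ↑ˡ n))
            upper j = value (b ! (n ↑ʳ j))

theorem15 :
  (∀ ℓ → ExcludedMiddle ℓ) → (∀ a b → Extensionality a b) →
  {Ω : Set} {_<_ : Rel Ω 0ℓ} (isω₁ : Isω₁ _<_) →
  let open Trees _<_ in
  (S : Pred Node 0ℓ) → IsSuslinTree S → Coherent S → Complete S →
  let open Families S in
  (𝓕 : Pred Family 0ℓ) → Is2ThinKurepa 𝓕 →
  Σ[ c ∈ ([S]^ 2 → Bool) ]
    ((s t : El) (s<t : value s <S value t) →
      Finite (λ x → Σ[ x<s ∈ value x <S value s ]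
        c (⟪ x , s ⟫ (proj₁ x<s)) ≢
        c (⟪ x , t ⟫ (Isω₁.<-trans isω₁ (proj₁ x<s) (proj₁ s<t)))))
  × (∀ α {s} → s ∈ S ↾ α → ∀ n .{{_ : NonZero n}} →
      (𝒜 : Family) → 𝒜 ∈ 𝓕 → 𝒜 ⊆ 𝒳 s n → HasSizeω₁ 𝒜 →
      (a : [S]^ 2) (a⊆ : ⟦ 2 , a ⟧ ⊆ level S α) →
      D (value (a ! zero)) (value (a ! suc zero)) ≐ ｛ ht s ｝ →
      Finite (λ (b : [S]^ (n + n)) →
        (n + n , b) ∈ 𝒜 ×
        Σ[ b⊆ ∈ ⟦ n + n , b ⟧ ⊆ S ↾ α ]
        ¬ (Σ[ i ∈ Bool ]
            (value (b ! (n ↑ʳ last n)) <S value (a ! suc zero) →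
             ∀ (j : Fin n) →
               c (cross b a b⊆ a⊆ (j ↑ˡ n) zero) ≡ i ×
               c (cross b a b⊆ a⊆ (n ↑ʳ j) (suc zero)) ≡ not i))))
theorem15 em ext isω₁ S _ _ _ 𝓕 kurepa with em _ {∃ 𝓕}
-- A constant colouring is coherent, and homogeneity is vacuous. In the other case a member of `𝓕`
-- supplies the default for enumerating traces.
... | no empty = (λ _ → false) , (λ _ _ _ → finite-subsingleton λ (_ , differ) → contradiction refl differ) ,
    λ _ _ _ _ 𝒜∈𝓕 → contradiction (_ , 𝒜∈𝓕) empty
  where open Classical em
... | yes nonempty = c , c-coherent , λ α _ n 𝒜 𝒜∈𝓕 𝒜⊆𝒳 _ a a⊆ _ → finite-⊆
    (λ (b∈𝒜 , b⊆ , inhomogeneous) → b∈𝒜 , b⊆ , λ (i , homogeneous) →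
      inhomogeneous (i , λ _ → homogeneous))
    (c-homogeneous α n 𝒜 𝒜∈𝓕 𝒜⊆𝒳 a a⊆ zero (suc zero))
  where
  open Classical em
  open Construction.Recursion em isω₁ S 𝓕 kurepa ext nonempty
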